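{- Let $m\ge 1$ and let $f:2^{[m]}\to\mathbb{R}_{\ge 0}$ be a set function with $f(\emptyset)=0$. Then $f$ is a coverage function if and only if all its $W$-coefficients are non-negative, i.e. $w(S)\ge 0$ for every non-empty $S\subseteq[m]$.
   Context: $[m]=\{1,\dots,m\}$. A function $f:2^{[m]}\to\mathbb{R}_{\ge 0}$ is a coverage function if there exist a finite set $U$ (the universe), weights $w_u\ge 0$ for $u\in U$, and sets $A_1,\dots,A_m\subseteq U$ such that $f(T)=\sum_{u\in\bigcup_{i\in T}A_i} w_u$ for all $T\subseteq[m]$. The $W$-coefficients of a set function $f$ are, for each non-empty $S\subseteq[m]$, $$w(S)=\sum_{T\subseteq[m]:\,S\cup T=[m]}(-1)^{|S\cap T|+1}f(T).$$ When $f(\emptyset)=0$ this is inverted by $f(T)=\sum_{S\subseteq[m]:\,S\cap T\ne\emptyset}w(S)$ for all $T\subseteq[m]$. -}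

module Defs where

import Data.Bool.Properties as Bool
open import Data.Fin.Base using (Fin)
open import Data.Fin.Subset using (Subset; inside; outside; ⊤; _∩_; _∪_; ⋃; ∣_∣)
open import Data.Fin.Subset.Properties using (_∈?_)
open import Data.List.Base using (List; []; _∷_; _++_; map; filter; foldr; allFin)
open import Data.Nat.Base as ℕ using (ℕ; zero; suc)
import Data.Nat.Properties as ℕ
open import Data.Product.Base using (∃-syntax; _,_)
open import Data.Rational.Base as ℚ using (ℚ; 0ℚ; ½)
import Data.Rational.Properties as ℚ
open import Data.Rational.Solver using (module +-*-Solver)
open import Data.Vec.Base as Vec using ()
open import Data.Vec.Properties using (≡-dec)
open import Relation.Binary.Definitions using (DecidableEquality)
open import Relation.Binary.PropositionalEquality using (_≡_; refl; sym; trans; cong; subst)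

------------------------------------------------------------------------
-- Real numbers: Cauchy sequences of rationals, compared by the setoid
-- equality _≃_ (the difference is a null sequence).

IsCauchy : (ℕ → ℚ) → Set
IsCauchy x = ∀ ε → 0ℚ ℚ.< ε →
  ∃[ N ] (∀ i j → N ℕ.≤ i → N ℕ.≤ j → ℚ.∣ x i ℚ.- x j ∣ ℚ.< ε)

record ℝ : Set where
  constructor mkℝ
  field
    seq      : ℕ → ℚ
    isCauchy : IsCauchy seq

open ℝ public

infix  4 _≃_ _≤_
infixl 6 _+_
infix  8 -_

_≃_ : ℝ → ℝ → Set
x ≃ y = ∀ ε → 0ℚ ℚ.< ε →
  ∃[ N ] (∀ n → N ℕ.≤ n → ℚ.∣ seq x n ℚ.- seq y n ∣ ℚ.< ε)

-- The sequences need only satisfy the inequality up to every ε > 0, so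
-- that _≤_ respects _≃_ and x ≃ y is the same as x ≤ y together with y ≤ x.
_≤_ : ℝ → ℝ → Set
x ≤ y = ∀ ε → 0ℚ ℚ.< ε →
  ∃[ N ] (∀ n → N ℕ.≤ n → seq x n ℚ.< seq y n ℚ.+ ε)

private
  half-pos : ∀ {ε} → 0ℚ ℚ.< ε → 0ℚ ℚ.< ½ ℚ.* ε
  half-pos {ε} 0<ε =
    subst (ℚ._< ½ ℚ.* ε) (ℚ.*-zeroʳ ½) (ℚ.*-monoʳ-<-pos ½ 0<ε)

  half+half : ∀ ε → ½ ℚ.* ε ℚ.+ ½ ℚ.* ε ≡ ε
  half+half ε =
    trans (sym (ℚ.*-distribʳ-+ ε ½ ½)) (ℚ.*-identityˡ ε)

  +-interchange-- : ∀ a b c d →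
    (a ℚ.+ b) ℚ.- (c ℚ.+ d) ≡ (a ℚ.- c) ℚ.+ (b ℚ.- d)
  +-interchange-- = solve 4
    (λ a b c d → (a :+ b) :- (c :+ d) := (a :- c) :+ (b :- d)) refl
    where open +-*-Solver

  ∣-‿-∣ : ∀ a b → ℚ.∣ (ℚ.- a) ℚ.- (ℚ.- b) ∣ ≡ ℚ.∣ a ℚ.- b ∣
  ∣-‿-∣ a b = trans (cong ℚ.∣_∣ (sym (ℚ.neg-distrib-+ a (ℚ.- b))))
                    (ℚ.∣-p∣≡∣p∣ (a ℚ.- b))

0ℝ : ℝ
0ℝ = mkℝ (λ _ → 0ℚ) (λ ε 0<ε → 0 , λ _ _ _ _ → 0<ε)

_+_ : ℝ → ℝ → ℝ
mkℝ x cx + mkℝ y cy = mkℝ (λ n → x n ℚ.+ y n) cauchy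
  where
  cauchy : IsCauchy (λ n → x n ℚ.+ y n)
  cauchy ε 0<ε with cx (½ ℚ.* ε) (half-pos 0<ε) | cy (½ ℚ.* ε) (half-pos 0<ε)
  ... | M , px | N , py = M ℕ.⊔ N , λ i j M⊔N≤i M⊔N≤j → begin-strict
    ℚ.∣ (x i ℚ.+ y i) ℚ.- (x j ℚ.+ y j) ∣
      ≡⟨ cong ℚ.∣_∣ (+-interchange-- (x i) (y i) (x j) (y j)) ⟩
    ℚ.∣ (x i ℚ.- x j) ℚ.+ (y i ℚ.- y j) ∣
      ≤⟨ ℚ.∣p+q∣≤∣p∣+∣q∣ (x i ℚ.- x j) (y i ℚ.- y j) ⟩
    ℚ.∣ x i ℚ.- x j ∣ ℚ.+ ℚ.∣ y i ℚ.- y j ∣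
      <⟨ ℚ.+-mono-< (px i j (ℕ.m⊔n≤o⇒m≤o M N M⊔N≤i) (ℕ.m⊔n≤o⇒m≤o M N M⊔N≤j))
                    (py i j (ℕ.m⊔n≤o⇒n≤o M N M⊔N≤i) (ℕ.m⊔n≤o⇒n≤o M N M⊔N≤j)) ⟩
    ½ ℚ.* ε ℚ.+ ½ ℚ.* ε
      ≡⟨ half+half ε ⟩
    ε ∎
    where open ℚ.≤-Reasoning

-_ : ℝ → ℝ
- mkℝ x cx = mkℝ (λ n → ℚ.- x n) cauchy
  where
  cauchy : IsCauchy (λ n → ℚ.- x n)
  cauchy ε 0<ε with cx ε 0<ε
  ... | N , px = N , λ i j N≤i N≤j →
    subst (ℚ._< ε) (sym (∣-‿-∣ (x i) (x j))) (px i j N≤i N≤j)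

-- (-1)ᵏ x, unfolded as k-fold negation so that no product of reals is needed.
infixr 7 [-1]^_·_

[-1]^_·_ : ℕ → ℝ → ℝ
[-1]^ zero  · x = x
[-1]^ suc k · x = - ([-1]^ k · x)

∑ : {A : Set} → List A → (A → ℝ) → ℝ
∑ xs g = foldr _+_ 0ℝ (map g xs)

infix 5 ∑
syntax ∑ xs (λ x → e) = ∑[ x ∈ xs ] e

------------------------------------------------------------------------
-- Finite sets.  The ground set [m] is Fin m.

_≟_ : ∀ {n} → DecidableEquality (Subset n)
_≟_ = ≡-dec Bool._≟_

-- Both enumerations list every item exactly once.
elements : ∀ {n} → Subset n → List (Fin n)
elements {n} p = filter (_∈? p) (allFin n)

subsets : ∀ n → List (Subset n)
subsets zero    = Vec.[] ∷ []
subsets (suc n) = map (inside Vec.∷_) (subsets n) ++ map (outside Vec.∷_) (subsets n)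

------------------------------------------------------------------------
-- Set functions

-- The universe is Fin size, as every finite set is in bijection with some Fin n.
record IsCoverage {m : ℕ} (f : Subset m → ℝ) : Set where
  field
    size     : ℕ
    weight   : Fin size → ℝ
    weight≥0 : ∀ u → 0ℝ ≤ weight u
    A        : Fin m → Subset size
    covers   : ∀ T → f T ≃ (∑[ u ∈ elements (⋃ (map A (elements T))) ] weight u)

wCoeff : ∀ {m} → (Subset m → ℝ) → Subset m → ℝ
wCoeff {m} f S =
  ∑[ T ∈ filter (λ T → (S ∪ T) ≟ ⊤) (subsets m) ] [-1]^ (∣ S ∩ T ∣ ℕ.+ 1) · f T

{-# OPTIONS --safe #-}

-- Splitting on the first element gives w_f (1 ∷ S) = w_{f₀} S − w_{f₁} S and
-- w_f (0 ∷ S) = w_{f₁} S, where fᵢ T = f (i ∷ T).  Two identities follow by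
-- induction on m:
--   Σ { w_f S ∣ S ∩ T = ∅ } = − f T,
--   T ↦ [B ∩ T = ∅] x has W-coefficient − [B = S] x at S.
-- Subtracting their instances at T = ∅ and B = ∅ turns "disjoint" into "meets".
-- The first becomes f T = Σ { w_f S ∣ S ∩ T ≠ ∅ }, which presents f as a
-- coverage function on the universe of subsets.  The second shows that a
-- coverage function has w S = Σ { w_u ∣ { i ∣ u ∈ A i } = S }.

module Submission where

open import Defs
open import Algebra.Bundles using (AbelianGroup)
import Algebra.Properties.AbelianGroup as AbelianGroupProperties
import Algebra.Properties.CommutativeSemigroup as CommutativeSemigroupProperties
open import Data.Bool.Base using (Bool; true; false; not; if_then_else_)
open import Data.Fin.Base using (Fin)
open import Data.Fin.Subset
  using (Subset; Nonempty; ⊥; ⊤; inside; outside; _∈_; _∩_; _∪_; ⋃; ∣_∣)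
open import Data.Fin.Subset.Properties
  using (_∈?_; nonempty?; Empty-unique; ∉⊥; x∈p∩q⁺; x∈p∩q⁻; x∈p∪q⁺; x∈p∪q⁻; ∩-zeroˡ; ∩-zeroʳ)
open import Data.Integer.Base using (+_; -[1+_])
open import Data.List.Base
  using (List; []; _∷_; _++_; map; filter; foldr; allFin; length; lookup)
open import Data.List.Membership.Propositional using (find; lose)
open import Data.List.Membership.Propositional.Properties
  using (∈-filter⁺; ∈-filter⁻; ∈-allFin)
open import Data.List.Properties using (map-∘; map-tabulate; tabulate-lookup)
open import Data.List.Relation.Unary.Any using (Any; here; there)
import Data.List.Relation.Unary.Any.Properties as Any
open import Data.Nat.Base as ℕ using (ℕ; zero; suc) renaming (_≤_ to _≤ℕ_)
import Data.Nat.Properties as ℕ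
open import Data.Product.Base using (∃-syntax; _,_; proj₂)
open import Data.Rational.Base as ℚ using (ℚ; 0ℚ; ½; mkℚ)
import Data.Rational.Properties as ℚ
open import Data.Rational.Solver using (module +-*-Solver)
open import Data.Sum.Base using (inj₁; inj₂)
open import Data.Vec.Base as Vec using ([]; _∷_)
import Data.Vec.Properties as Vec
open import Function.Base using (_∘_; id)
open import Function.Bundles using (_⇔_; mk⇔)
open import Function.Construct.Composition using (_⇔-∘_)
open import Level using (0ℓ)
open import Relation.Binary.PropositionalEquality as ≡ using (_≡_; _≢_; cong; subst)
open import Relation.Nullary.Decidable
  using (Dec; yes; no; does; ¬?; does-⇔; dec-true; dec-false)
open import Relation.Nullary.Negation using (contradiction)
open import Relation.Unary using (Pred; Decidable)

-- Disjoint subsets and transposed set families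

-- A Boolean that computes on first entries: it reduces to `false` when both are `inside` and to the
-- value on the tails otherwise. The inductions on `m` below rely on these reductions.
disjoint : ∀ {n} → Subset n → Subset n → Bool
disjoint S T = does ((S ∩ T) ≟ ⊥)

disjoint-⊥ˡ : ∀ {n} (T : Subset n) → disjoint ⊥ T ≡ true
disjoint-⊥ˡ T = dec-true ((⊥ ∩ T) ≟ ⊥) (∩-zeroˡ T)

disjoint-⊥ʳ : ∀ {n} (S : Subset n) → disjoint S ⊥ ≡ true
disjoint-⊥ʳ S = dec-true ((S ∩ ⊥) ≟ ⊥) (∩-zeroʳ S)

∈-⋃⁺ : ∀ {n} {u : Fin n} {ps} → Any (u ∈_) ps → u ∈ ⋃ ps
∈-⋃⁺ (here u∈p)   = x∈p∪q⁺ (inj₁ u∈p)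
∈-⋃⁺ (there u∈ps) = x∈p∪q⁺ (inj₂ (∈-⋃⁺ u∈ps))

∈-⋃⁻ : ∀ {n} {u : Fin n} ps → u ∈ ⋃ ps → Any (u ∈_) ps
∈-⋃⁻ []       u∈⊥ = contradiction u∈⊥ ∉⊥
∈-⋃⁻ (p ∷ ps) u∈p∪ps with x∈p∪q⁻ p (⋃ ps) u∈p∪ps
... | inj₁ u∈p  = here u∈p
... | inj₂ u∈ps = there (∈-⋃⁻ ps u∈ps)

Nonempty⇔≢⊥ : ∀ {n} (p : Subset n) → Nonempty p ⇔ (p ≢ ⊥)
Nonempty⇔≢⊥ p = mk⇔ (λ (i , i∈p) p≡⊥ → ∉⊥ (subst (i ∈_) p≡⊥ i∈p)) from
  where
  from : p ≢ ⊥ → Nonempty p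
  from p≢⊥ with nonempty? p
  ... | yes ne = ne
  ... | no  e  = contradiction (Empty-unique e) p≢⊥

module _ {m n} (A : Fin m → Subset n) where

  -- The incidence matrix of the family read by columns: `transpose u` collects the indices of the
  -- sets that contain `u`.
  transpose : Fin n → Subset m
  transpose u = Vec.tabulate λ i → Vec.lookup (A i) u

  ∈-transpose⁺ : ∀ {i u} → u ∈ A i → i ∈ transpose u
  ∈-transpose⁺ {i} {u} u∈Ai = Vec.lookup⇒[]= i (transpose u)
    (≡.trans (Vec.lookup∘tabulate _ i) (Vec.[]=⇒lookup u∈Ai))

  ∈-transpose⁻ : ∀ {i u} → i ∈ transpose u → u ∈ A i
  ∈-transpose⁻ {i} {u} i∈Au = Vec.lookup⇒[]= u (A i)
    (≡.trans (≡.sym (Vec.lookup∘tabulate _ i)) (Vec.[]=⇒lookup i∈Au))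

  ∈-⋃-elements⇔ : ∀ T u → u ∈ ⋃ (map A (elements T)) ⇔ Nonempty (transpose u ∩ T)
  ∈-⋃-elements⇔ T u = mk⇔ to from
    where
    to : u ∈ ⋃ (map A (elements T)) → Nonempty (transpose u ∩ T)
    to u∈⋃ with find (Any.map⁻ (∈-⋃⁻ (map A (elements T)) u∈⋃))
    ... | i , i∈T , u∈Ai =
      i , x∈p∩q⁺ (∈-transpose⁺ u∈Ai , proj₂ (∈-filter⁻ (_∈? T) {xs = allFin m} i∈T))

    from : Nonempty (transpose u ∩ T) → u ∈ ⋃ (map A (elements T))
    from (i , i∈Au∩T) with x∈p∩q⁻ (transpose u) T i∈Au∩T
    ... | i∈Au , i∈T = ∈-⋃⁺ (Any.map⁺ (lose
      (∈-filter⁺ (_∈? T) (∈-allFin i) i∈T) (∈-transpose⁻ i∈Au)))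

  -- A point is covered by `T` exactly when some index of a set containing it lies in `T`. The
  -- dependence on `T` is thereby reduced to meeting a fixed subset of the ground set.
  does-∈?-⋃-elements : ∀ T u →
    does (u ∈? ⋃ (map A (elements T))) ≡ not (disjoint (transpose u) T)
  does-∈?-⋃-elements T u = does-⇔ (Nonempty⇔≢⊥ _ ⇔-∘ ∈-⋃-elements⇔ T u)
    (u ∈? ⋃ (map A (elements T))) (¬? ((transpose u ∩ T) ≟ ⊥))

-- Needed for the converse, where the covering family is itself a transpose.
transpose-involutive : ∀ {m n} (A : Fin m → Subset n) i → transpose (transpose A) i ≡ A i
transpose-involutive A i = ≡.trans
  (Vec.tabulate-cong λ u → Vec.lookup∘tabulate (λ i → Vec.lookup (A i) u) i)
  (Vec.tabulate∘lookup (A i))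

-- W-coefficients with values in an abelian group

-- The algebra is done in an abstract group rather than directly in ℝ, where
-- conversion checking would also unfold and compare the Cauchy proofs.
module AbelianGroupValued {c ℓ} (G : AbelianGroup c ℓ) where

  open AbelianGroup G hiding (_-_) renaming (_∙_ to _⊕_; ε to 𝟘; _⁻¹ to infix 8 ⊖_)
  open AbelianGroupProperties G using (ε⁻¹≈ε; ⁻¹-∙-comm; \\-leftDividesˡ; x∙y⁻¹≈ε⇒x≈y)
  open CommutativeSemigroupProperties commutativeSemigroup using (interchange)
  open import Relation.Binary.Reasoning.Setoid setoid

  -- Signs, indicators and finite sums.

  sgn : ℕ → Carrier → Carrier
  sgn zero    x = x
  sgn (suc k) x = ⊖ sgn k x

  ⨁ : {A : Set} → List A → (A → Carrier) → Carrier
  ⨁ xs g = foldr _⊕_ 𝟘 (map g xs)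

  infix 5 ⨁
  syntax ⨁ xs (λ x → e) = ⨁[ x ∈ xs ] e

  wCoeffᴳ : ∀ {m} → (Subset m → Carrier) → Subset m → Carrier
  wCoeffᴳ {m} f S =
    ⨁[ T ∈ filter (λ T → (S ∪ T) ≟ ⊤) (subsets m) ] sgn (∣ S ∩ T ∣ ℕ.+ 1) (f T)

  infixr 8 1[_]·_

  -- The Iverson bracket times `x`, given by a case distinction because a group has no product.
  1[_]·_ : Bool → Carrier → Carrier
  1[ b ]· x = if b then x else 𝟘

  1·-cong : ∀ b {x y} → x ≈ y → 1[ b ]· x ≈ 1[ b ]· y
  1·-cong true  x≈y = x≈y
  1·-cong false _   = refl

  1·-+ : ∀ b x y → 1[ b ]· (x ⊕ y) ≈ 1[ b ]· x ⊕ 1[ b ]· y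
  1·-+ true  _ _ = refl
  1·-+ false _ _ = sym (identityˡ 𝟘)

  1·-neg : ∀ b x → 1[ b ]· ⊖ x ≈ ⊖ 1[ b ]· x
  1·-neg true  _ = refl
  1·-neg false _ = sym ε⁻¹≈ε

  1·-complement : ∀ b x → 1[ not b ]· x ⊕ 1[ b ]· x ≈ x
  1·-complement true  x = identityˡ x
  1·-complement false x = identityʳ x

  sgn-cong : ∀ k {x y} → x ≈ y → sgn k x ≈ sgn k y
  sgn-cong zero    x≈y = x≈y
  sgn-cong (suc k) x≈y = ⁻¹-cong (sgn-cong k x≈y)

  sgn-0 : ∀ k → sgn k 𝟘 ≈ 𝟘
  sgn-0 zero    = refl
  sgn-0 (suc k) = trans (⁻¹-cong (sgn-0 k)) ε⁻¹≈ε

  sgn-+ : ∀ k x y → sgn k (x ⊕ y) ≈ sgn k x ⊕ sgn k y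
  sgn-+ zero    _ _ = refl
  sgn-+ (suc k) x y =
    trans (⁻¹-cong (sgn-+ k x y)) (sym (⁻¹-∙-comm (sgn k x) (sgn k y)))

  module _ {A : Set} where

    ⨁-cong : ∀ (xs : List A) {g h} → (∀ a → g a ≈ h a) → ⨁ xs g ≈ ⨁ xs h
    ⨁-cong []       _   = refl
    ⨁-cong (x ∷ xs) g≈h = ∙-cong (g≈h x) (⨁-cong xs g≈h)

    ⨁-0 : ∀ (xs : List A) → ⨁ xs (λ _ → 𝟘) ≈ 𝟘
    ⨁-0 []       = refl
    ⨁-0 (_ ∷ xs) = trans (identityˡ _) (⨁-0 xs)

    ⨁-+ : ∀ (xs : List A) g h → ⨁ xs (λ a → g a ⊕ h a) ≈ ⨁ xs g ⊕ ⨁ xs h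
    ⨁-+ []       g h = sym (identityˡ 𝟘)
    ⨁-+ (x ∷ xs) g h = begin
      (g x ⊕ h x) ⊕ ⨁ xs (λ a → g a ⊕ h a)  ≈⟨ ∙-congˡ (⨁-+ xs g h) ⟩
      (g x ⊕ h x) ⊕ (⨁ xs g ⊕ ⨁ xs h)       ≈⟨ interchange (g x) (h x) (⨁ xs g) (⨁ xs h) ⟩
      (g x ⊕ ⨁ xs g) ⊕ (h x ⊕ ⨁ xs h)       ∎

    ⨁-neg : ∀ (xs : List A) g → ⨁ xs (λ a → ⊖ g a) ≈ ⊖ ⨁ xs g
    ⨁-neg []       g = sym ε⁻¹≈ε
    ⨁-neg (x ∷ xs) g = trans (∙-congˡ (⨁-neg xs g)) (⁻¹-∙-comm (g x) (⨁ xs g))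

    ⨁-++ : ∀ (xs ys : List A) g → ⨁ (xs ++ ys) g ≈ ⨁ xs g ⊕ ⨁ ys g
    ⨁-++ []       ys g = sym (identityˡ (⨁ ys g))
    ⨁-++ (x ∷ xs) ys g =
      trans (∙-congˡ (⨁-++ xs ys g)) (sym (assoc (g x) (⨁ xs g) (⨁ ys g)))

    ⨁-map : ∀ {B : Set} (xs : List B) (φ : B → A) g → ⨁ (map φ xs) g ≡ ⨁ xs (g ∘ φ)
    ⨁-map xs φ g = cong (foldr _⊕_ 𝟘) (≡.sym (map-∘ xs))

    ⨁-filter : ∀ {P : Pred A 0ℓ} (P? : Decidable P) xs g →
      ⨁ (filter P? xs) g ≈ ⨁ xs (λ a → 1[ does (P? a) ]· g a)
    ⨁-filter P? []       g = refl
    ⨁-filter P? (x ∷ xs) g with does (P? x)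
    ... | true  = ∙-congˡ (⨁-filter P? xs g)
    ... | false = trans (⨁-filter P? xs g) (sym (identityˡ _))

    -- A universe has to be some `Fin n`, so a sum over subsets is reindexed by positions in their
    -- enumeration.
    ⨁-allFin-lookup : ∀ (xs : List A) g → ⨁ (allFin (length xs)) (g ∘ lookup xs) ≡ ⨁ xs g
    ⨁-allFin-lookup xs g = ≡.trans (≡.sym (⨁-map (allFin _) (lookup xs) g))
      (cong (λ ys → ⨁ ys g) (≡.trans (map-tabulate id (lookup xs)) (tabulate-lookup xs)))

  ⨁-subsets-suc : ∀ {n} (g : Subset (suc n) → Carrier) →
    ⨁ (subsets (suc n)) g ≈
    ⨁ (subsets n) (g ∘ (inside ∷_)) ⊕ ⨁ (subsets n) (g ∘ (outside ∷_))
  ⨁-subsets-suc {n} g = begin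
    ⨁ (subsets (suc n)) g
      ≈⟨ ⨁-++ (map (inside ∷_) (subsets n)) (map (outside ∷_) (subsets n)) g ⟩
    ⨁ (map (inside ∷_) (subsets n)) g ⊕ ⨁ (map (outside ∷_) (subsets n)) g
      ≡⟨ ≡.cong₂ _⊕_ (⨁-map (subsets n) (inside ∷_) g) (⨁-map (subsets n) (outside ∷_) g) ⟩
    ⨁ (subsets n) (g ∘ (inside ∷_)) ⊕ ⨁ (subsets n) (g ∘ (outside ∷_))  ∎

  -- Linearity of W-coefficients and their recursion on the first element.

  wCoeffᴳ-cong : ∀ {m} {f g : Subset m → Carrier} → (∀ T → f T ≈ g T) →
    ∀ S → wCoeffᴳ f S ≈ wCoeffᴳ g S
  wCoeffᴳ-cong {m} f≈g S = ⨁-cong (filter (λ T → (S ∪ T) ≟ ⊤) (subsets m))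
    λ T → sgn-cong (∣ S ∩ T ∣ ℕ.+ 1) (f≈g T)

  wCoeffᴳ-0 : ∀ {m} (S : Subset m) → wCoeffᴳ (λ _ → 𝟘) S ≈ 𝟘
  wCoeffᴳ-0 {m} S = trans (⨁-cong Ts λ T → sgn-0 (∣ S ∩ T ∣ ℕ.+ 1)) (⨁-0 Ts)
    where Ts = filter (λ T → (S ∪ T) ≟ ⊤) (subsets m)

  wCoeffᴳ-+ : ∀ {m} (f g : Subset m → Carrier) S →
    wCoeffᴳ (λ T → f T ⊕ g T) S ≈ wCoeffᴳ f S ⊕ wCoeffᴳ g S
  wCoeffᴳ-+ {m} f g S = trans
    (⨁-cong Ts λ T → sgn-+ (∣ S ∩ T ∣ ℕ.+ 1) (f T) (g T))
    (⨁-+ Ts (λ T → sgn (∣ S ∩ T ∣ ℕ.+ 1) (f T)) (λ T → sgn (∣ S ∩ T ∣ ℕ.+ 1) (g T)))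
    where Ts = filter (λ T → (S ∪ T) ≟ ⊤) (subsets m)

  -- Linearity lets a coverage function be treated one point of its universe at a time.
  wCoeffᴳ-⨁ : ∀ {m} {A : Set} (xs : List A) (F : A → Subset m → Carrier) S →
    wCoeffᴳ (λ T → ⨁[ a ∈ xs ] F a T) S ≈ (⨁[ a ∈ xs ] wCoeffᴳ (F a) S)
  wCoeffᴳ-⨁ []       F S = wCoeffᴳ-0 S
  wCoeffᴳ-⨁ (x ∷ xs) F S =
    trans (wCoeffᴳ-+ (F x) (λ T → ⨁[ a ∈ xs ] F a T) S) (∙-congˡ (wCoeffᴳ-⨁ xs F S))

  -- The condition on `S ∪ T` becomes an indicator, so that the sum runs over all subsets and splits
  -- at the first element of `T`.
  wTerm : ∀ {m} → (Subset m → Carrier) → Subset m → Subset m → Carrier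
  wTerm f S T = 1[ does ((S ∪ T) ≟ ⊤) ]· sgn (∣ S ∩ T ∣ ℕ.+ 1) (f T)

  wCoeffᴳ≈⨁wTerm : ∀ {m} (f : Subset m → Carrier) S → wCoeffᴳ f S ≈ ⨁ (subsets m) (wTerm f S)
  wCoeffᴳ≈⨁wTerm f S = ⨁-filter (λ T → (S ∪ T) ≟ ⊤) (subsets _) _

  -- The first element is already in the union, so `T` may contain it or not; containing it enlarges
  -- the intersection by one and flips the sign.
  wCoeffᴳ-inside : ∀ {m} (f : Subset (suc m) → Carrier) S →
    wCoeffᴳ f (inside ∷ S) ≈ ⊖ wCoeffᴳ (f ∘ (inside ∷_)) S ⊕ wCoeffᴳ (f ∘ (outside ∷_)) S
  wCoeffᴳ-inside {m} f S = begin
    wCoeffᴳ f (inside ∷ S)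
      ≈⟨ wCoeffᴳ≈⨁wTerm f (inside ∷ S) ⟩
    ⨁ (subsets (suc m)) (wTerm f (inside ∷ S))
      ≈⟨ ⨁-subsets-suc (wTerm f (inside ∷ S)) ⟩
    ⨁ (subsets m) (λ T → 1[ does ((S ∪ T) ≟ ⊤) ]· ⊖ sgn (∣ S ∩ T ∣ ℕ.+ 1) (f (inside ∷ T))) ⊕
    ⨁ (subsets m) (wTerm (f ∘ (outside ∷_)) S)
      ≈⟨ ∙-congʳ (trans (⨁-cong (subsets m) λ T → 1·-neg (does ((S ∪ T) ≟ ⊤)) _)
                       (⨁-neg (subsets m) (wTerm (f ∘ (inside ∷_)) S))) ⟩
    ⊖ ⨁ (subsets m) (wTerm (f ∘ (inside ∷_)) S) ⊕ ⨁ (subsets m) (wTerm (f ∘ (outside ∷_)) S)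
      ≈⟨ ∙-cong (⁻¹-cong (wCoeffᴳ≈⨁wTerm (f ∘ (inside ∷_)) S))
                (wCoeffᴳ≈⨁wTerm (f ∘ (outside ∷_)) S) ⟨
    ⊖ wCoeffᴳ (f ∘ (inside ∷_)) S ⊕ wCoeffᴳ (f ∘ (outside ∷_)) S  ∎

  -- Here `T` has to supply the first element, which leaves the size of the intersection unchanged;
  -- the other half of the sum vanishes.
  wCoeffᴳ-outside : ∀ {m} (f : Subset (suc m) → Carrier) S →
    wCoeffᴳ f (outside ∷ S) ≈ wCoeffᴳ (f ∘ (inside ∷_)) S
  wCoeffᴳ-outside {m} f S = begin
    wCoeffᴳ f (outside ∷ S)
      ≈⟨ wCoeffᴳ≈⨁wTerm f (outside ∷ S) ⟩
    ⨁ (subsets (suc m)) (wTerm f (outside ∷ S))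
      ≈⟨ ⨁-subsets-suc (wTerm f (outside ∷ S)) ⟩
    ⨁ (subsets m) (wTerm (f ∘ (inside ∷_)) S) ⊕ ⨁ (subsets m) (λ _ → 𝟘)
      ≈⟨ ∙-congˡ (⨁-0 (subsets m)) ⟩
    ⨁ (subsets m) (wTerm (f ∘ (inside ∷_)) S) ⊕ 𝟘
      ≈⟨ identityʳ _ ⟩
    ⨁ (subsets m) (wTerm (f ∘ (inside ∷_)) S)
      ≈⟨ wCoeffᴳ≈⨁wTerm (f ∘ (inside ∷_)) S ⟨
    wCoeffᴳ (f ∘ (inside ∷_)) S  ∎

  -- If `T` contains the first element, `S` must avoid it and only the coefficients of
  -- `f ∘ (inside ∷_)` remain. Otherwise both choices for `S` count, these coefficients cancel, and
  -- those of `f ∘ (outside ∷_)` remain.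
  ⨁-disjoint-wCoeffᴳ : ∀ {m} (f : Subset m → Carrier) T →
    (⨁[ S ∈ subsets m ] 1[ disjoint S T ]· wCoeffᴳ f S) ≈ ⊖ f T
  ⨁-disjoint-wCoeffᴳ f [] = begin
    -- The minus sign comes from the `+ 1` in the exponent; the two zeros end the two one-term sums.
    (⊖ f [] ⊕ 𝟘) ⊕ 𝟘  ≈⟨ identityʳ _ ⟩
    ⊖ f [] ⊕ 𝟘         ≈⟨ identityʳ _ ⟩
    ⊖ f []              ∎
  ⨁-disjoint-wCoeffᴳ {suc m} f (inside ∷ T) = begin
    (⨁[ S ∈ subsets (suc m) ] 1[ disjoint S (inside ∷ T) ]· wCoeffᴳ f S)
      ≈⟨ ⨁-subsets-suc (λ S → 1[ disjoint S (inside ∷ T) ]· wCoeffᴳ f S) ⟩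
    (⨁[ S ∈ subsets m ] 𝟘) ⊕ (⨁[ S ∈ subsets m ] 1[ disjoint S T ]· wCoeffᴳ f (outside ∷ S))
      ≈⟨ ∙-cong (⨁-0 (subsets m))
                (⨁-cong (subsets m) λ S → 1·-cong (disjoint S T) (wCoeffᴳ-outside f S)) ⟩
    𝟘 ⊕ (⨁[ S ∈ subsets m ] 1[ disjoint S T ]· wCoeffᴳ (f ∘ (inside ∷_)) S)
      ≈⟨ identityˡ _ ⟩
    (⨁[ S ∈ subsets m ] 1[ disjoint S T ]· wCoeffᴳ (f ∘ (inside ∷_)) S)
      ≈⟨ ⨁-disjoint-wCoeffᴳ (f ∘ (inside ∷_)) T ⟩
    ⊖ f (inside ∷ T)  ∎
  ⨁-disjoint-wCoeffᴳ {suc m} f (outside ∷ T) = begin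
    (⨁[ S ∈ subsets (suc m) ] 1[ disjoint S (outside ∷ T) ]· wCoeffᴳ f S)
      ≈⟨ ⨁-subsets-suc (λ S → 1[ disjoint S (outside ∷ T) ]· wCoeffᴳ f S) ⟩
    (⨁[ S ∈ subsets m ] 1[ disjoint S T ]· wCoeffᴳ f (inside ∷ S)) ⊕
    (⨁[ S ∈ subsets m ] 1[ disjoint S T ]· wCoeffᴳ f (outside ∷ S))
      ≈⟨ ⨁-+ (subsets m) _ _ ⟨
    (⨁[ S ∈ subsets m ] (1[ disjoint S T ]· wCoeffᴳ f (inside ∷ S) ⊕
                         1[ disjoint S T ]· wCoeffᴳ f (outside ∷ S)))
      ≈⟨ ⨁-cong (subsets m) (λ S → trans (sym (1·-+ (disjoint S T) _ _))
                                         (1·-cong (disjoint S T) (cancel S))) ⟩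
    (⨁[ S ∈ subsets m ] 1[ disjoint S T ]· wCoeffᴳ (f ∘ (outside ∷_)) S)
      ≈⟨ ⨁-disjoint-wCoeffᴳ (f ∘ (outside ∷_)) T ⟩
    ⊖ f (outside ∷ T)  ∎
    where
    cancel : ∀ S → wCoeffᴳ f (inside ∷ S) ⊕ wCoeffᴳ f (outside ∷ S) ≈
                   wCoeffᴳ (f ∘ (outside ∷_)) S
    cancel S = begin
      wCoeffᴳ f (inside ∷ S) ⊕ wCoeffᴳ f (outside ∷ S)
        ≈⟨ ∙-cong (wCoeffᴳ-inside f S) (wCoeffᴳ-outside f S) ⟩
      (⊖ wCoeffᴳ (f ∘ (inside ∷_)) S ⊕ wCoeffᴳ (f ∘ (outside ∷_)) S) ⊕
      wCoeffᴳ (f ∘ (inside ∷_)) S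
        ≈⟨ comm _ _ ⟩
      wCoeffᴳ (f ∘ (inside ∷_)) S ⊕
      (⊖ wCoeffᴳ (f ∘ (inside ∷_)) S ⊕ wCoeffᴳ (f ∘ (outside ∷_)) S)
        ≈⟨ \\-leftDividesˡ (wCoeffᴳ (f ∘ (inside ∷_)) S) (wCoeffᴳ (f ∘ (outside ∷_)) S) ⟩
      wCoeffᴳ (f ∘ (outside ∷_)) S  ∎

  -- If `B` contains the first element, the function vanishes on every `inside ∷ T`; if not, its two
  -- halves coincide. Equal first entries of `B` and `S` thus lead to the tails, and unequal ones
  -- give zero, by vanishing or by cancellation.
  wCoeffᴳ-disjoint : ∀ {m} (B : Subset m) x S →
    wCoeffᴳ (λ T → 1[ disjoint B T ]· x) S ≈ ⊖ 1[ does (B ≟ S) ]· x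
  wCoeffᴳ-disjoint [] x [] = identityʳ (⊖ x)
  wCoeffᴳ-disjoint (inside ∷ B) x (inside ∷ S) = begin
    wCoeffᴳ (λ T → 1[ disjoint (inside ∷ B) T ]· x) (inside ∷ S)
      ≈⟨ wCoeffᴳ-inside (λ T → 1[ disjoint (inside ∷ B) T ]· x) S ⟩
    ⊖ wCoeffᴳ (λ T → 𝟘) S ⊕ wCoeffᴳ (λ T → 1[ disjoint B T ]· x) S
      ≈⟨ ∙-cong (trans (⁻¹-cong (wCoeffᴳ-0 S)) ε⁻¹≈ε) (wCoeffᴳ-disjoint B x S) ⟩
    𝟘 ⊕ ⊖ 1[ does (B ≟ S) ]· x
      ≈⟨ identityˡ _ ⟩
    ⊖ 1[ does (B ≟ S) ]· x  ∎
  wCoeffᴳ-disjoint (inside ∷ B) x (outside ∷ S) = begin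
    wCoeffᴳ (λ T → 1[ disjoint (inside ∷ B) T ]· x) (outside ∷ S)
      ≈⟨ wCoeffᴳ-outside (λ T → 1[ disjoint (inside ∷ B) T ]· x) S ⟩
    wCoeffᴳ (λ T → 𝟘) S
      ≈⟨ wCoeffᴳ-0 S ⟩
    𝟘
      ≈⟨ ε⁻¹≈ε ⟨
    ⊖ 𝟘  ∎
  wCoeffᴳ-disjoint (outside ∷ B) x (inside ∷ S) = begin
    wCoeffᴳ (λ T → 1[ disjoint (outside ∷ B) T ]· x) (inside ∷ S)
      ≈⟨ wCoeffᴳ-inside (λ T → 1[ disjoint (outside ∷ B) T ]· x) S ⟩
    ⊖ wCoeffᴳ (λ T → 1[ disjoint B T ]· x) S ⊕ wCoeffᴳ (λ T → 1[ disjoint B T ]· x) S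
      ≈⟨ inverseˡ _ ⟩
    𝟘
      ≈⟨ ε⁻¹≈ε ⟨
    ⊖ 𝟘  ∎
  wCoeffᴳ-disjoint (outside ∷ B) x (outside ∷ S) = begin
    wCoeffᴳ (λ T → 1[ disjoint (outside ∷ B) T ]· x) (outside ∷ S)
      ≈⟨ wCoeffᴳ-outside (λ T → 1[ disjoint (outside ∷ B) T ]· x) S ⟩
    wCoeffᴳ (λ T → 1[ disjoint B T ]· x) S
      ≈⟨ wCoeffᴳ-disjoint B x S ⟩
    ⊖ 1[ does (B ≟ S) ]· x  ∎

  ⨁-meets-wCoeffᴳ : ∀ {m} (f : Subset m → Carrier) → f ⊥ ≈ 𝟘 → ∀ T →
    (⨁[ S ∈ subsets m ] 1[ not (disjoint S T) ]· wCoeffᴳ f S) ≈ f T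
  ⨁-meets-wCoeffᴳ {m} f f⊥≈𝟘 T = x∙y⁻¹≈ε⇒x≈y _ (f T) (begin
    (⨁[ S ∈ subsets m ] 1[ not (disjoint S T) ]· wCoeffᴳ f S) ⊕ ⊖ f T
      ≈⟨ ∙-congˡ (⨁-disjoint-wCoeffᴳ f T) ⟨
    (⨁[ S ∈ subsets m ] 1[ not (disjoint S T) ]· wCoeffᴳ f S) ⊕
    (⨁[ S ∈ subsets m ] 1[ disjoint S T ]· wCoeffᴳ f S)
      ≈⟨ ⨁-+ (subsets m) _ _ ⟨
    (⨁[ S ∈ subsets m ] (1[ not (disjoint S T) ]· wCoeffᴳ f S ⊕ 1[ disjoint S T ]· wCoeffᴳ f S))
      ≈⟨ ⨁-cong (subsets m) (λ S → 1·-complement (disjoint S T) (wCoeffᴳ f S)) ⟩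
    -- Every `S` is disjoint from `⊥`, so the total of all coefficients is the disjoint sum at `⊥`,
    -- which is zero by `f⊥≈𝟘`.
    (⨁[ S ∈ subsets m ] wCoeffᴳ f S)
      ≈⟨ ⨁-cong (subsets m) (λ S → reflexive (cong (1[_]· wCoeffᴳ f S) (disjoint-⊥ʳ S))) ⟨
    (⨁[ S ∈ subsets m ] 1[ disjoint S ⊥ ]· wCoeffᴳ f S)
      ≈⟨ ⨁-disjoint-wCoeffᴳ f ⊥ ⟩
    ⊖ f ⊥
      ≈⟨ ⁻¹-cong f⊥≈𝟘 ⟩
    ⊖ 𝟘
      ≈⟨ ε⁻¹≈ε ⟩
    𝟘  ∎)

  wCoeffᴳ-meets : ∀ {m} (B : Subset m) x {S} → Nonempty S →
    wCoeffᴳ (λ T → 1[ not (disjoint B T) ]· x) S ≈ 1[ does (B ≟ S) ]· x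
  wCoeffᴳ-meets {m} B x {S} (i , i∈S) = x∙y⁻¹≈ε⇒x≈y _ (1[ does (B ≟ S) ]· x) (begin
    wCoeffᴳ (λ T → 1[ not (disjoint B T) ]· x) S ⊕ ⊖ 1[ does (B ≟ S) ]· x
      ≈⟨ ∙-congˡ (wCoeffᴳ-disjoint B x S) ⟨
    wCoeffᴳ (λ T → 1[ not (disjoint B T) ]· x) S ⊕ wCoeffᴳ (λ T → 1[ disjoint B T ]· x) S
      ≈⟨ wCoeffᴳ-+ (λ T → 1[ not (disjoint B T) ]· x) (λ T → 1[ disjoint B T ]· x) S ⟨
    wCoeffᴳ (λ T → 1[ not (disjoint B T) ]· x ⊕ 1[ disjoint B T ]· x) S
      -- The two indicators add up to the constant function `x`, which is the disjointness function
      -- of `⊥`; its coefficient at a non-empty `S` is zero.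
      ≈⟨ wCoeffᴳ-cong (λ T → trans (1·-complement (disjoint B T) x)
                                   (reflexive (cong (1[_]· x) (≡.sym (disjoint-⊥ˡ T))))) S ⟩
    wCoeffᴳ (λ T → 1[ disjoint ⊥ T ]· x) S
      ≈⟨ wCoeffᴳ-disjoint ⊥ x S ⟩
    ⊖ 1[ does (⊥ ≟ S) ]· x
      ≡⟨ cong (λ b → ⊖ 1[ b ]· x)
              (dec-false (⊥ ≟ S) λ ⊥≡S → ∉⊥ (subst (i ∈_) (≡.sym ⊥≡S) i∈S)) ⟩
    ⊖ 𝟘
      ≈⟨ ε⁻¹≈ε ⟩
    𝟘  ∎)

-- The real numbers as an abelian group

Eventually : (ℕ → Set) → Set
Eventually P = ∃[ N ] (∀ n → N ℕ.≤ n → P n)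

eventually-zip : {P Q R : ℕ → Set} → (∀ n → P n → Q n → R n) →
  Eventually P → Eventually Q → Eventually R
eventually-zip f (M , p) (N , q) = M ℕ.⊔ N , λ n M⊔N≤n →
  f n (p n (ℕ.m⊔n≤o⇒m≤o M N M⊔N≤n)) (q n (ℕ.m⊔n≤o⇒n≤o M N M⊔N≤n))

eventually-map : {P Q : ℕ → Set} → (∀ n → P n → Q n) → Eventually P → Eventually Q
eventually-map f (N , p) = N , λ n N≤n → f n (p n N≤n)

0<½*ε : ∀ {ε} → 0ℚ ℚ.< ε → 0ℚ ℚ.< ½ ℚ.* ε
0<½*ε {ε} 0<ε = subst (ℚ._< ½ ℚ.* ε) (ℚ.*-zeroʳ ½) (ℚ.*-monoʳ-<-pos ½ 0<ε)

½*ε+½*ε≡ε : ∀ ε → ½ ℚ.* ε ℚ.+ ½ ℚ.* ε ≡ ε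
½*ε+½*ε≡ε ε = ≡.trans (≡.sym (ℚ.*-distribʳ-+ ε ½ ½)) (ℚ.*-identityˡ ε)

p≤∣p∣ : ∀ p → p ℚ.≤ ℚ.∣ p ∣
p≤∣p∣ (mkℚ (+ _) _ _)        = ℚ.≤-refl
p≤∣p∣ p@(mkℚ (-[1+ _ ]) _ _) =
  ℚ.≤-trans (ℚ.<⇒≤ (ℚ.negative⁻¹ p)) (ℚ.nonNegative⁻¹ ℚ.∣ p ∣)

-- By definition `x ≃ y` says that the difference sequence is `Null`. Congruence laws thus reduce to
-- closure properties of null sequences and ring identities in `ℚ`.
Null : (ℕ → ℚ) → Set
Null d = ∀ ε → 0ℚ ℚ.< ε → Eventually (λ n → ℚ.∣ d n ∣ ℚ.< ε)

Null-resp-≡ : ∀ {d e} → (∀ n → d n ≡ e n) → Null d → Null e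
Null-resp-≡ d≡e d ε 0<ε =
  eventually-map (λ n → subst (λ p → ℚ.∣ p ∣ ℚ.< ε) (d≡e n)) (d ε 0<ε)

Null-+ : ∀ {d e} → Null d → Null e → Null (λ n → d n ℚ.+ e n)
Null-+ {d} {e} nd ne ε 0<ε =
  eventually-zip step (nd (½ ℚ.* ε) (0<½*ε 0<ε)) (ne (½ ℚ.* ε) (0<½*ε 0<ε))
  where
  open ℚ.≤-Reasoning
  step : ∀ n → ℚ.∣ d n ∣ ℚ.< ½ ℚ.* ε → ℚ.∣ e n ∣ ℚ.< ½ ℚ.* ε →
    ℚ.∣ d n ℚ.+ e n ∣ ℚ.< ε
  step n d<½ε e<½ε = begin-strict
    ℚ.∣ d n ℚ.+ e n ∣          ≤⟨ ℚ.∣p+q∣≤∣p∣+∣q∣ (d n) (e n) ⟩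
    ℚ.∣ d n ∣ ℚ.+ ℚ.∣ e n ∣    <⟨ ℚ.+-mono-< d<½ε e<½ε ⟩
    ½ ℚ.* ε ℚ.+ ½ ℚ.* ε        ≡⟨ ½*ε+½*ε≡ε ε ⟩
    ε                          ∎

Null-neg : ∀ {d} → Null d → Null (λ n → ℚ.- d n)
Null-neg {d} nd ε 0<ε =
  eventually-map (λ n → subst (ℚ._< ε) (≡.sym (ℚ.∣-p∣≡∣p∣ (d n)))) (nd ε 0<ε)

Null-0 : Null (λ _ → 0ℚ)
Null-0 _ 0<ε = 0 , λ _ _ → 0<ε

-- A record, so that both sides can be inferred from a proof: _≃_ unfolds to a
-- statement about the sequences alone.
infix 4 _≈_
record _≈_ (x y : ℝ) : Set where
  constructor ≃⇒≈
  field ≈⇒≃ : x ≃ y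
open _≈_

pointwise : ∀ {x y} → (∀ n → seq x n ≡ seq y n) → x ≈ y
pointwise {x} {y} x≡y = ≃⇒≈ (Null-resp-≡ (λ n → ≡.sym (x-y≡0 n)) Null-0)
  where
  open ≡.≡-Reasoning
  x-y≡0 : ∀ n → seq x n ℚ.- seq y n ≡ 0ℚ
  x-y≡0 n = begin
    seq x n ℚ.- seq y n  ≡⟨ cong (ℚ._- seq y n) (x≡y n) ⟩
    seq y n ℚ.- seq y n  ≡⟨ ℚ.+-inverseʳ (seq y n) ⟩
    0ℚ                   ∎

module _ where
  open +-*-Solver

  ≈-sym : ∀ {x y} → x ≈ y → y ≈ x
  ≈-sym {x} {y} (≃⇒≈ x≃y) = ≃⇒≈ (Null-resp-≡
    (λ n → solve 2 (λ x y → :- (x :- y) := y :- x) ≡.refl (seq x n) (seq y n))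
    (Null-neg x≃y))

  ≈-trans : ∀ {x y z} → x ≈ y → y ≈ z → x ≈ z
  ≈-trans {x} {y} {z} (≃⇒≈ x≃y) (≃⇒≈ y≃z) = ≃⇒≈ (Null-resp-≡
    (λ n → solve 3 (λ x y z → (x :- y) :+ (y :- z) := x :- z) ≡.refl
                   (seq x n) (seq y n) (seq z n))
    (Null-+ x≃y y≃z))

  +-cong : ∀ {x y u v} → x ≈ y → u ≈ v → x + u ≈ y + v
  +-cong {x} {y} {u} {v} (≃⇒≈ x≃y) (≃⇒≈ u≃v) = ≃⇒≈ (Null-resp-≡
    (λ n → solve 4 (λ x y u v → (x :- y) :+ (u :- v) := (x :+ u) :- (y :+ v)) ≡.refl
                   (seq x n) (seq y n) (seq u n) (seq v n))
    (Null-+ x≃y u≃v))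

  neg-cong : ∀ {x y} → x ≈ y → - x ≈ - y
  neg-cong {x} {y} (≃⇒≈ x≃y) = ≃⇒≈ (Null-resp-≡
    (λ n → solve 2 (λ x y → :- (x :- y) := :- x :- :- y) ≡.refl (seq x n) (seq y n))
    (Null-neg x≃y))

+-abelianGroup : AbelianGroup 0ℓ 0ℓ
+-abelianGroup = record
  { Carrier = ℝ
  ; _≈_ = _≈_
  ; _∙_ = _+_
  ; ε = 0ℝ
  ; _⁻¹ = -_
  ; isAbelianGroup = record
    { isGroup = record
      { isMonoid = record
        { isSemigroup = record
          { isMagma = record
            { isEquivalence = record
              { refl = pointwise (λ _ → ≡.refl) ; sym = ≈-sym ; trans = ≈-trans }
            ; ∙-cong = +-cong
            }
          ; assoc = λ x y z → pointwise λ n → ℚ.+-assoc (seq x n) (seq y n) (seq z n)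
          }
        ; identity = (λ x → pointwise λ n → ℚ.+-identityˡ (seq x n))
                   , (λ x → pointwise λ n → ℚ.+-identityʳ (seq x n))
        }
      ; inverse = (λ x → pointwise λ n → ℚ.+-inverseˡ (seq x n))
                , (λ x → pointwise λ n → ℚ.+-inverseʳ (seq x n))
      ; ⁻¹-cong = neg-cong
      }
    ; comm = λ x y → pointwise λ n → ℚ.+-comm (seq x n) (seq y n)
    }
  }

-- Non-negative reals.

0≤0 : 0ℝ ≤ 0ℝ
0≤0 ε 0<ε = 0 , λ _ _ → subst (0ℚ ℚ.<_) (≡.sym (ℚ.+-identityˡ ε)) 0<ε

0≤+ : ∀ {x y} → 0ℝ ≤ x → 0ℝ ≤ y → 0ℝ ≤ x + y
0≤+ {x} {y} 0≤x 0≤y ε 0<ε =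
  eventually-zip step (0≤x (½ ℚ.* ε) (0<½*ε 0<ε)) (0≤y (½ ℚ.* ε) (0<½*ε 0<ε))
  where
  open ℚ.≤-Reasoning
  step : ∀ n → 0ℚ ℚ.< seq x n ℚ.+ ½ ℚ.* ε → 0ℚ ℚ.< seq y n ℚ.+ ½ ℚ.* ε →
    0ℚ ℚ.< (seq x n ℚ.+ seq y n) ℚ.+ ε
  step n 0<x+½ε 0<y+½ε = begin-strict
    0ℚ ℚ.+ 0ℚ
      <⟨ ℚ.+-mono-< 0<x+½ε 0<y+½ε ⟩
    (seq x n ℚ.+ ½ ℚ.* ε) ℚ.+ (seq y n ℚ.+ ½ ℚ.* ε)
      ≡⟨ solve 3 (λ x y h → (x :+ h) :+ (y :+ h) := (x :+ y) :+ (h :+ h)) ≡.refl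
               (seq x n) (seq y n) (½ ℚ.* ε) ⟩
    (seq x n ℚ.+ seq y n) ℚ.+ (½ ℚ.* ε ℚ.+ ½ ℚ.* ε)
      ≡⟨ cong (seq x n ℚ.+ seq y n ℚ.+_) (½*ε+½*ε≡ε ε) ⟩
    (seq x n ℚ.+ seq y n) ℚ.+ ε  ∎
    where open +-*-Solver

0≤-resp-≈ : ∀ {x y} → x ≈ y → 0ℝ ≤ x → 0ℝ ≤ y
0≤-resp-≈ {x} {y} (≃⇒≈ x≃y) 0≤x ε 0<ε =
  eventually-zip step (0≤x (½ ℚ.* ε) (0<½*ε 0<ε)) (x≃y (½ ℚ.* ε) (0<½*ε 0<ε))
  where
  open ℚ.≤-Reasoning
  step : ∀ n → 0ℚ ℚ.< seq x n ℚ.+ ½ ℚ.* ε → ℚ.∣ seq x n ℚ.- seq y n ∣ ℚ.< ½ ℚ.* ε →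
    0ℚ ℚ.< seq y n ℚ.+ ε
  step n 0<x+½ε ∣x-y∣<½ε = begin-strict
    0ℚ
      <⟨ 0<x+½ε ⟩
    seq x n ℚ.+ ½ ℚ.* ε
      ≡⟨ solve 3 (λ x y h → x :+ h := (x :- y) :+ (y :+ h)) ≡.refl
               (seq x n) (seq y n) (½ ℚ.* ε) ⟩
    (seq x n ℚ.- seq y n) ℚ.+ (seq y n ℚ.+ ½ ℚ.* ε)
      -- Replacing `x` by `y` costs less than half of `ε`; the other half is the slack in the bound
      -- on `x`.
      <⟨ ℚ.+-monoˡ-< (seq y n ℚ.+ ½ ℚ.* ε) (ℚ.≤-<-trans (p≤∣p∣ _) ∣x-y∣<½ε) ⟩
    ½ ℚ.* ε ℚ.+ (seq y n ℚ.+ ½ ℚ.* ε)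
      ≡⟨ solve 2 (λ y h → h :+ (y :+ h) := y :+ (h :+ h)) ≡.refl
               (seq y n) (½ ℚ.* ε) ⟩
    seq y n ℚ.+ (½ ℚ.* ε ℚ.+ ½ ℚ.* ε)
      ≡⟨ cong (seq y n ℚ.+_) (½*ε+½*ε≡ε ε) ⟩
    seq y n ℚ.+ ε  ∎
    where open +-*-Solver

-- The equivalence

open AbelianGroupValued +-abelianGroup
private module ℝ+ = AbelianGroup +-abelianGroup
open import Relation.Binary.Reasoning.Setoid ℝ+.setoid

0≤⨁ : ∀ {A : Set} (xs : List A) {g} → (∀ a → 0ℝ ≤ g a) → 0ℝ ≤ ⨁ xs g
0≤⨁ []       _       = 0≤0
0≤⨁ (x ∷ xs) {g} 0≤g = 0≤+ {g x} {⨁ xs g} (0≤g x) (0≤⨁ xs 0≤g)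

-- The bound on `x` may depend on `P`: coefficients are assumed non-negative for non-empty sets
-- only.
0≤1· : ∀ {P : Set} (P? : Dec P) {x} → (P → 0ℝ ≤ x) → 0ℝ ≤ 1[ does P? ]· x
0≤1· (yes p) 0≤x = 0≤x p
0≤1· (no _)  _   = 0≤0

-- Two separate recursions with the same clauses, identified by induction on `k`.
[-1]^≡sgn : ∀ k x → [-1]^ k · x ≡ sgn k x
[-1]^≡sgn zero    x = ≡.refl
[-1]^≡sgn (suc k) x = cong -_ ([-1]^≡sgn k x)

wCoeff≈wCoeffᴳ : ∀ {m} (f : Subset m → ℝ) S → wCoeff f S ≈ wCoeffᴳ f S
wCoeff≈wCoeffᴳ {m} f S = ⨁-cong (filter (λ T → (S ∪ T) ≟ ⊤) (subsets m))
  λ T → ℝ+.reflexive ([-1]^≡sgn (∣ S ∩ T ∣ ℕ.+ 1) (f T))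

∑-covered : ∀ {m n} (A : Fin m → Subset n) (w : Fin n → ℝ) T →
  ∑ (elements (⋃ (map A (elements T)))) w ≈
  (⨁[ u ∈ allFin n ] 1[ not (disjoint (transpose A u) T) ]· w u)
∑-covered {n = n} A w T = ℝ+.trans
  (⨁-filter (_∈? ⋃ (map A (elements T))) (allFin n) w)
  (⨁-cong (allFin n) λ u → ℝ+.reflexive (cong (1[_]· w u) (does-∈?-⋃-elements A T u)))

IsCoverage⇒0≤wCoeff : ∀ {m} {f : Subset m → ℝ} → IsCoverage f →
  ∀ S → Nonempty S → 0ℝ ≤ wCoeff f S
IsCoverage⇒0≤wCoeff {m} {f} cov S S≢∅ = 0≤-resp-≈ (ℝ+.sym wCoeff≈)
  (0≤⨁ (allFin size) λ u → 0≤1· (B u ≟ S) λ _ → weight≥0 u)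
  where
  open IsCoverage cov
  B : Fin size → Subset m
  B = transpose A

  wCoeff≈ : wCoeff f S ≈ (⨁[ u ∈ allFin size ] 1[ does (B u ≟ S) ]· weight u)
  wCoeff≈ = begin
    wCoeff f S
      ≈⟨ wCoeff≈wCoeffᴳ f S ⟩
    wCoeffᴳ f S
      ≈⟨ wCoeffᴳ-cong (λ T → ℝ+.trans (≃⇒≈ (covers T)) (∑-covered A weight T)) S ⟩
    wCoeffᴳ (λ T → ⨁[ u ∈ allFin size ] 1[ not (disjoint (B u) T) ]· weight u) S
      ≈⟨ wCoeffᴳ-⨁ (allFin size) (λ u T → 1[ not (disjoint (B u) T) ]· weight u) S ⟩
    (⨁[ u ∈ allFin size ] wCoeffᴳ (λ T → 1[ not (disjoint (B u) T) ]· weight u) S)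
      -- A point contributes its weight exactly when the sets containing it are those indexed by
      -- `S`.
      ≈⟨ ⨁-cong (allFin size) (λ u → wCoeffᴳ-meets (B u) (weight u) S≢∅) ⟩
    (⨁[ u ∈ allFin size ] 1[ does (B u ≟ S) ]· weight u)  ∎

-- The universe is the power set of [m], with A i = { S ∣ i ∈ S }; ∅ belongs to
-- no A i, and its weight is set to 0 because w(∅) = − f [m].
0≤wCoeff⇒IsCoverage : ∀ {m} {f : Subset m → ℝ} → f ⊥ ≃ 0ℝ →
  (∀ S → Nonempty S → 0ℝ ≤ wCoeff f S) → IsCoverage f
0≤wCoeff⇒IsCoverage {m} {f} f⊥≃0 0≤w = record
  { size     = length (subsets m)
  ; weight   = v ∘ set
  ; weight≥0 = λ u → 0≤1· (nonempty? (set u)) (0≤w (set u))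
  ; A        = transpose set
  ; covers   = λ T → ≈⇒≃ (f≈ T)
  }
  where
  set : Fin (length (subsets m)) → Subset m
  set = lookup (subsets m)

  v : Subset m → ℝ
  v S = 1[ does (nonempty? S) ]· wCoeff f S

  v-meets : ∀ S T →
    1[ not (disjoint S T) ]· wCoeffᴳ f S ≈ 1[ not (disjoint S T) ]· v S
  v-meets S T with nonempty? S
  ... | yes _   = 1·-cong (not (disjoint S T)) (ℝ+.sym (wCoeff≈wCoeffᴳ f S))
  -- The empty set meets no `T`, so its altered weight never enters the sum.
  ... | no  S≡∅ rewrite Empty-unique S≡∅ | disjoint-⊥ˡ T = ℝ+.refl

  f≈ : ∀ T → f T ≈ ∑ (elements (⋃ (map (transpose set) (elements T)))) (v ∘ set)
  f≈ T = begin
    f T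
      ≈⟨ ⨁-meets-wCoeffᴳ f (≃⇒≈ f⊥≃0) T ⟨
    (⨁[ S ∈ subsets m ] 1[ not (disjoint S T) ]· wCoeffᴳ f S)
      ≈⟨ ⨁-cong (subsets m) (λ S → v-meets S T) ⟩
    (⨁[ S ∈ subsets m ] 1[ not (disjoint S T) ]· v S)
      ≡⟨ ⨁-allFin-lookup (subsets m) (λ S → 1[ not (disjoint S T) ]· v S) ⟨
    (⨁[ u ∈ allFin _ ] 1[ not (disjoint (set u) T) ]· v (set u))
      -- The family `transpose set` is transposed once more by `∑-covered`, which returns the
      -- enumeration `set`.
      ≈⟨ ⨁-cong (allFin _) (λ u → ℝ+.reflexive
           (cong (λ S → 1[ not (disjoint S T) ]· v (set u)) (transpose-involutive set u))) ⟨
    (⨁[ u ∈ allFin _ ] 1[ not (disjoint (transpose (transpose set) u) T) ]· v (set u))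
      ≈⟨ ∑-covered (transpose set) (v ∘ set) T ⟨
    ∑ (elements (⋃ (map (transpose set) (elements T)))) (v ∘ set)  ∎

theorem1p1 : (m : ℕ) → 1 ≤ℕ m → (f : Subset m → ℝ) →
    (∀ T → 0ℝ ≤ f T) → f ⊥ ≃ 0ℝ →
    IsCoverage f ⇔ (∀ S → Nonempty S → 0ℝ ≤ wCoeff f S)
theorem1p1 m _ f _ f⊥≃0 = mk⇔ IsCoverage⇒0≤wCoeff (0≤wCoeff⇒IsCoverage f⊥≃0)
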